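{- Let $m \equiv 3 \pmod 4$ and $n \equiv 1 \pmod 4$ be two distinct square-free positive integers, and let $K = \mathbb{Q}(\sqrt{ -m},\sqrt{n})$. If $s(\mathcal{O}_K) = 2$, then $g(\mathcal{O}_K) = 3$.
   Context: For a number field $K$, $\mathcal{O}_K$ denotes its ring of integers. $s(\mathcal{O}_K)$ is the minimal number of squares required to represent $-1$ in $\mathcal{O}_K$, i.e. the smallest positive integer $s$ such that $-1$ is a sum of $s$ squares of elements of $\mathcal{O}_K$. $g(\mathcal{O}_K)$ is the smallest positive integer $t$ such that every element of $\mathcal{O}_K$ is a sum of $t$ squares of elements of $\mathcal{O}_K$ (zero summands allowed). -}

module Defs where

open import Level using (Level; _⊔_)
open import Algebra.Apartness.Bundles using (HeytingField; HeytingCommutativeRing)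
open import Algebra.Bundles using (CommutativeRing)
open import Data.Fin.Base using (Fin)
open import Data.Integer.Base using (ℤ; +_; -[1+_])
open import Data.List.Base using (List; []; _∷_)
open import Data.Nat.Base as ℕ using (ℕ; suc; NonZero)
open import Data.Nat.Divisibility using (_∣_)
open import Data.Product.Base using (Σ-syntax; ∃-syntax; _×_)
open import Relation.Binary.Definitions using (Decidable)
open import Relation.Binary.PropositionalEquality.Core using (_≡_)

SquareFree : ℕ → Set
SquareFree n = ∀ d → (d ℕ.* d) ∣ n → d ≡ 1

IsLeastPositive : {p : Level} → (ℕ → Set p) → ℕ → Set p
IsLeastPositive P k =
  NonZero k × P k × (∀ j → NonZero j → P j → k ℕ.≤ j)

module _ {c ℓ₁ ℓ₂ : Level} (K : HeytingField c ℓ₁ ℓ₂) where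

  open HeytingField K

  private
    ring : CommutativeRing c ℓ₁
    ring = HeytingCommutativeRing.commutativeRing heytingCommutativeRing

  open CommutativeRing ring using (semiring; +-monoid)
  open import Algebra.Properties.Semiring.Mult semiring using () renaming (_×_ to _·_)
  open import Algebra.Properties.Monoid.Sum +-monoid using (sum)

  fromℕ : ℕ → Carrier
  fromℕ n = n · 1#

  fromℤ : ℤ → Carrier
  fromℤ (+ n)    = fromℕ n
  fromℤ -[1+ n ] = - fromℕ (suc n)

  -- The smallest subfield containing α and β; in characteristic zero it
  -- contains the prime field ℚ, so it is ℚ(α, β).
  data InSubfield (α β : Carrier) : Carrier → Set (c ⊔ ℓ₁) where
    α-in    : InSubfield α β α
    β-in    : InSubfield α β β
    0#-in   : InSubfield α β 0#
    1#-in   : InSubfield α β 1#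
    +-in    : ∀ {x y} → InSubfield α β x → InSubfield α β y → InSubfield α β (x + y)
    neg-in  : ∀ {x} → InSubfield α β x → InSubfield α β (- x)
    *-in    : ∀ {x y} → InSubfield α β x → InSubfield α β y → InSubfield α β (x * y)
    inv-in  : ∀ {x y} → x * y ≈ 1# → InSubfield α β x → InSubfield α β y
    resp-in : ∀ {x y} → x ≈ y → InSubfield α β x → InSubfield α β y

  -- K is (a copy of) ℚ(√-m, √n): a field of characteristic zero generated by
  -- a square root of -m and a square root of n.  This determines K up to
  -- isomorphism, also when n is a perfect square (then β = ±√n is rational).
  -- A Heyting field with decidable apartness is a field in the ordinary sense:
  -- equality is decidable and every nonzero element is invertible.
  record IsℚAdjoin√ (m n : ℕ) : Set (c ⊔ ℓ₁ ⊔ ℓ₂) where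
    field
      discrete           : Decidable _#_
      characteristicZero : ∀ k → fromℕ k ≈ 0# → k ≡ 0
      α β                : Carrier
      α²≈-m              : α * α ≈ - fromℕ m
      β²≈n               : β * β ≈ fromℕ n
      generated          : ∀ x → InSubfield α β x

  -- The list c₀ ∷ … ∷ c_{d-1} ∷ [] stands for the monic polynomial
  -- c₀ + c₁ X + … + c_{d-1} X^{d-1} + X^d.
  evalMonic : List ℤ → Carrier → Carrier
  evalMonic []       x = 1#
  evalMonic (a ∷ as) x = fromℤ a + x * evalMonic as x

  -- Membership in the ring of integers 𝓞_K, the integral closure of ℤ in K.
  Integral : Carrier → Set ℓ₁
  Integral x = ∃[ p ] evalMonic p x ≈ 0#

  IsSumOfSquares : ℕ → Carrier → Set (c ⊔ ℓ₁)
  IsSumOfSquares k x =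
    Σ[ y ∈ (Fin k → Carrier) ] ((∀ i → Integral (y i)) × x ≈ sum (λ i → y i * y i))

  -- s(𝓞_K) = k and g(𝓞_K) = k, stated as relations since the minimum need
  -- not exist for an arbitrary K.
  s[𝓞]≡ : ℕ → Set (c ⊔ ℓ₁)
  s[𝓞]≡ = IsLeastPositive (λ k → IsSumOfSquares k (- 1#))

  g[𝓞]≡ : ℕ → Set (c ⊔ ℓ₁)
  g[𝓞]≡ = IsLeastPositive (λ k → ∀ x → Integral x → IsSumOfSquares k x)

{-# OPTIONS --safe #-}

-- Put δ = (1 + √-m)/2 and ε = (1 + √n)/2. The order A = ℤ[δ, ε] satisfies x⁴ ≡ x modulo 2, so A/2 is
-- reduced, and from this every integral element has an odd denominator with respect to A. Hence
-- x⁴ ≡ x modulo 2 in 𝒪 as well. Integrality is handled through the equivalent condition that the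
-- powers of x have a common denominator with respect to A, for which the ring axioms are immediate.
--
-- Let -1 = a² + b² in 𝒪. Every x is a square modulo 2, and the isotropic vector (a, b, 1) of
-- X² + Y² + Z² turns a representation modulo 2 into an exact one, so three squares suffice. Modulo 2,
-- a² + a = 1, while 1 + 2a = e² + f² would force a ≡ e² + e and so a² + a ≡ e⁴ - e ≡ 0: two squares
-- do not suffice for 1 + 2a.
module Submission where

open import Defs
open import Level using (Level; _⊔_)
open import Algebra.Apartness.Bundles using (HeytingField; HeytingCommutativeRing)
import Algebra.Apartness.Properties.HeytingCommutativeRing as HeytingCommutativeRingProperties
open import Algebra.Bundles using (CommutativeRing)
import Algebra.Solver.Ring as RingSolver
import Algebra.Solver.Ring.AlmostCommutativeRing as ACR
open import Data.Fin.Base as Fin using (Fin; toℕ; fromℕ<; combine)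
import Data.Fin.Properties as Fin
open import Data.Integer.Base as ℤ using (ℤ; +_; -[1+_])
open import Data.Integer.DivMod using (n%ℕd<d; a≡a%ℕn+[a/ℕn]*n)
import Data.Integer.Properties as ℤ
open import Data.List.Base using ([]; _∷_; length)
open import Data.Maybe.Base as Maybe using (Maybe)
open import Data.Nat.Base as ℕ using (ℕ; zero; suc; NonZero; _%_; _/_)
open import Data.Nat.DivMod using (m≡m%n+[m/n]*n)
open import Data.Nat.Induction using (<-rec)
import Data.Nat.Properties as ℕ
open import Data.Product.Base using (∃-syntax; Σ-syntax; _×_; _,_; proj₁; proj₂)
open import Data.Sum.Base using (_⊎_; inj₁; inj₂)
open import Data.Vec.Base using (lookup; []; _∷_)
open import Relation.Binary.Consequences using (dec⇒weaklyDec)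
open import Relation.Binary.Definitions using (Decidable)
open import Relation.Binary.PropositionalEquality.Core as ≡ using (_≡_; _≢_)
open import Relation.Nullary using (¬_; Dec; yes; no)
open import Relation.Nullary.Negation using (contradiction)

-- The homomorphism from ℤ to K and the ring solver over it.

module Integers {c ℓ₁ ℓ₂} (K : HeytingField c ℓ₁ ℓ₂) where

  commutativeRing : CommutativeRing c ℓ₁
  commutativeRing = HeytingCommutativeRing.commutativeRing (HeytingField.heytingCommutativeRing K)

  open CommutativeRing commutativeRing
  open import Algebra.Properties.Ring ring using (-0#≈0#; -‿involutive; -‿distribˡ-*)
  open import Algebra.Properties.AbelianGroup +-abelianGroup using (⁻¹-∙-comm)
  open import Algebra.Properties.CommutativeSemigroup +-commutativeSemigroup using (interchange)
  open import Algebra.Properties.Semiring.Mult semiring using (×-homo-+)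
  open import Relation.Binary.Reasoning.Setoid setoid

  ι : ℤ → Carrier
  ι = fromℤ K

  ι-⊖ : ∀ m n → ι (m ℤ.⊖ n) ≈ fromℕ K m - fromℕ K n
  ι-⊖ zero    zero    = sym (-‿inverseʳ 0#)
  ι-⊖ zero    (suc n) = sym (+-identityˡ _)
  ι-⊖ (suc m) zero    = sym (trans (+-congˡ -0#≈0#) (+-identityʳ _))
  ι-⊖ (suc m) (suc n) = begin
    ι (suc m ℤ.⊖ suc n)                     ≡⟨ ≡.cong ι (ℤ.[1+m]⊖[1+n]≡m⊖n m n) ⟩
    ι (m ℤ.⊖ n)                             ≈⟨ ι-⊖ m n ⟩
    fromℕ K m - fromℕ K n                   ≈⟨ +-identityˡ _ ⟨
    0# + (fromℕ K m - fromℕ K n)            ≈⟨ +-congʳ (-‿inverseʳ 1#) ⟨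
    (1# - 1#) + (fromℕ K m - fromℕ K n)     ≈⟨ interchange _ _ _ _ ⟩
    fromℕ K (suc m) + (- 1# - fromℕ K n)    ≈⟨ +-congˡ (⁻¹-∙-comm _ _) ⟩
    fromℕ K (suc m) - fromℕ K (suc n)       ∎

  ι-neg : ∀ i → ι (ℤ.- i) ≈ - ι i
  ι-neg (+ zero)  = sym -0#≈0#
  ι-neg (+ suc n) = refl
  ι-neg -[1+ n ]  = sym (-‿involutive _)

  ι-+ : ∀ i j → ι (i ℤ.+ j) ≈ ι i + ι j
  ι-+ (+ m)    (+ n)    = ×-homo-+ 1# m n
  ι-+ (+ m)    -[1+ n ] = ι-⊖ m (suc n)
  ι-+ -[1+ m ] (+ n)    = trans (ι-⊖ n (suc m)) (+-comm _ _)
  ι-+ -[1+ m ] -[1+ n ] = begin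
    - fromℕ K (suc (suc (m ℕ.+ n)))           ≡⟨ ≡.cong (λ k → - fromℕ K (suc k)) (ℕ.+-suc m n) ⟨
    - fromℕ K (suc m ℕ.+ suc n)               ≈⟨ -‿cong (×-homo-+ 1# (suc m) (suc n)) ⟩
    - (fromℕ K (suc m) + fromℕ K (suc n))     ≈⟨ ⁻¹-∙-comm _ _ ⟨
    - fromℕ K (suc m) - fromℕ K (suc n)       ∎

  ι-1 : ι (+ 1) ≈ 1#
  ι-1 = +-identityʳ 1#

  ι-*⁺ : ∀ m j → ι (+ m ℤ.* j) ≈ fromℕ K m * ι j
  ι-*⁺ zero    j = trans (reflexive (≡.cong ι (ℤ.*-zeroˡ j))) (sym (zeroˡ _))
  ι-*⁺ (suc m) j = begin
    ι (+ suc m ℤ.* j)               ≡⟨ ≡.cong ι (ℤ.suc-* (+ m) j) ⟩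
    ι (j ℤ.+ + m ℤ.* j)             ≈⟨ ι-+ j (+ m ℤ.* j) ⟩
    ι j + ι (+ m ℤ.* j)             ≈⟨ +-cong (sym (*-identityˡ _)) (ι-*⁺ m j) ⟩
    1# * ι j + fromℕ K m * ι j      ≈⟨ distribʳ _ _ _ ⟨
    fromℕ K (suc m) * ι j           ∎

  ι-* : ∀ i j → ι (i ℤ.* j) ≈ ι i * ι j
  ι-* (+ m)    j = ι-*⁺ m j
  ι-* -[1+ m ] j = begin
    ι (-[1+ m ] ℤ.* j)              ≡⟨ ≡.cong ι (ℤ.neg-distribˡ-* (+ suc m) j) ⟨
    ι (ℤ.- (+ suc m ℤ.* j))         ≈⟨ ι-neg (+ suc m ℤ.* j) ⟩
    - ι (+ suc m ℤ.* j)             ≈⟨ -‿cong (ι-*⁺ (suc m) j) ⟩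
    - (fromℕ K (suc m) * ι j)       ≈⟨ -‿distribˡ-* _ _ ⟩
    - fromℕ K (suc m) * ι j         ∎

  ι-morphism : ℤ.+-*-rawRing ACR.-Raw-AlmostCommutative⟶ ACR.fromCommutativeRing commutativeRing
  ι-morphism = record { ⟦_⟧ = ι ; +-homo = ι-+ ; *-homo = ι-* ; -‿homo = ι-neg ; 0-homo = refl ; 1-homo = ι-1 }

  ι≈ι? : ∀ i j → Maybe (ι i ≈ ι j)
  ι≈ι? i j = Maybe.map (λ i≡j → reflexive (≡.cong ι i≡j)) (dec⇒weaklyDec ℤ._≟_ i j)

  -- Integer coefficients, on which equality is decidable, let the solver cancel terms. It has no
  -- constant for 1#, only ι 1, which is 1# + 0#; in solver expressions 1# is therefore written x :^ 0.
  module Solver = RingSolver ℤ.+-*-rawRing (ACR.fromCommutativeRing commutativeRing) ι-morphism ι≈ι?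

-- Subrings of K: divisibility by 2 and polynomials of bounded degree.

module Subrings {c ℓ₁ ℓ₂} (K : HeytingField c ℓ₁ ℓ₂) where

  open Integers K public
  open CommutativeRing commutativeRing public hiding (ring; zero)
  open import Algebra.Properties.Semiring.Mult semiring public using (×-homo-+; ×-congˡ; ×1-homo-*)
  open import Algebra.Properties.CommutativeSemiring.Exp commutativeSemiring public
    using (_^_; ^-congˡ; ^-distrib-*; ^-homo-*)
  open Solver public

  2# : Carrier
  2# = ι (+ 2)

  -- The solver proves only unconditional polynomial identities. A hypothesis `p ≈ q` enters through
  -- an explicit cofactor `k`, whose multiple of `p - q` vanishes; nested uses bring in several
  -- hypotheses.
  ≈-modulo : ∀ {x y p q} k → x ≈ y + k * (p - q) → p ≈ q → x ≈ y
  ≈-modulo {x} {y} {p} {q} k x≈ p≈q =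
    trans x≈ (trans (+-congˡ (trans (*-congˡ (trans (+-congʳ p≈q) (-‿inverseʳ q))) (zeroʳ k))) (+-identityʳ y))

  record IsSubring {p} (A : Carrier → Set p) : Set (c ⊔ ℓ₁ ⊔ p) where
    infixl 6 _+∈_ _-∈_
    infixl 7 _*∈_
    infix  8 -∈_
    field
      resp : ∀ {x y} → x ≈ y → A x → A y
      _+∈_ : ∀ {x y} → A x → A y → A (x + y)
      _*∈_ : ∀ {x y} → A x → A y → A (x * y)
      -∈_  : ∀ {x} → A x → A (- x)
      1∈   : A 1#

    _-∈_ : ∀ {x y} → A x → A y → A (x - y)
    p -∈ q = p +∈ -∈ q

    0∈ : A 0#
    0∈ = resp (-‿inverseʳ 1#) (1∈ -∈ 1∈)

    fromℕ∈ : ∀ n → A (fromℕ K n)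
    fromℕ∈ zero    = 0∈
    fromℕ∈ (suc n) = 1∈ +∈ fromℕ∈ n

    ι∈ : ∀ i → A (ι i)
    ι∈ (+ n)    = fromℕ∈ n
    ι∈ -[1+ n ] = -∈ fromℕ∈ (suc n)

    ^∈ : ∀ {x} n → A x → A (x ^ n)
    ^∈ zero    p = 1∈
    ^∈ (suc n) p = p *∈ ^∈ n p

  -- The half must lie in `A`: where 2 is invertible, every element of K is a multiple of 2.
  Even : ∀ {p} → (Carrier → Set p) → Carrier → Set (c ⊔ ℓ₁ ⊔ p)
  Even A x = ∃[ z ] (A z × x ≈ 2# * z)

  module Parity {p} {A : Carrier → Set p} (S : IsSubring A) where
    open IsSubring S

    2*-even : ∀ {x} → A x → Even A (2# * x)
    2*-even p = _ , p , refl

    even-resp : ∀ {x y} → x ≈ y → Even A x → Even A y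
    even-resp x≈y (z , p , x≈2z) = z , p , trans (sym x≈y) x≈2z

    even-+ : ∀ {x y} → Even A x → Even A y → Even A (x + y)
    even-+ (z , p , e) (w , q , f) = z + w , p +∈ q , trans (+-cong e f) (sym (distribˡ _ _ _))

    even-* : ∀ {x y} → A x → Even A y → Even A (x * y)
    even-* {x} q (z , p , e) = x * z , q *∈ p ,
      trans (*-congˡ e) (solve 2 (λ x z → x :* (con (+ 2) :* z) := con (+ 2) :* (x :* z)) refl x z)

    even-neg : ∀ {x} → Even A x → Even A (- x)
    even-neg {x} e = even-resp (solve 1 (λ x → con (ℤ.- (+ 1)) :* x := :- x) refl x) (even-* (ι∈ (ℤ.- (+ 1))) e)

    -- x = x⁴ - (x⁴ - x), and x⁴ is a multiple of x². This is how nilpotents modulo 2 are excluded.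
    even-root : ∀ {x} → A x → Even A (x ^ 4 - x) → Even A (x * x) → Even A x
    even-root {x} p e f = even-resp (solve 1 (λ x → x :* x :* (x :* x) :+ :- (x :^ 4 :- x) := x) refl x)
      (even-+ (even-* (p *∈ p) f) (even-neg e))

  -- Low A x d y: y is the value at x of a polynomial of degree < d over A.
  data Low {p} (A : Carrier → Set p) (x : Carrier) : ℕ → Carrier → Set (c ⊔ ℓ₁ ⊔ p) where
    nil  : ∀ {y} → y ≈ 0# → Low A x zero y
    cons : ∀ {d y a q} → A a → Low A x d q → y ≈ a + x * q → Low A x (suc d) y

  -- A monic equation of degree d, solved for its leading term.
  IntegralOver : ∀ {p} → (Carrier → Set p) → Carrier → Set (c ⊔ ℓ₁ ⊔ p)
  IntegralOver A x = ∃[ d ] Low A x d (x ^ d)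

  module LowDegree {p} {A : Carrier → Set p} (S : IsSubring A) {x : Carrier} where
    open IsSubring S

    low-resp : ∀ {d y z} → y ≈ z → Low A x d y → Low A x d z
    low-resp y≈z (nil e)      = nil (trans (sym y≈z) e)
    low-resp y≈z (cons p l e) = cons p l (trans (sym y≈z) e)

    low-0 : ∀ d → Low A x d 0#
    low-0 zero    = nil refl
    low-0 (suc d) = cons 0∈ (low-0 d) (solve 1 (λ x → con (+ 0) := con (+ 0) :+ x :* con (+ 0)) refl x)

    low-const : ∀ {d a} → A a → Low A x (suc d) a
    low-const {d} {a} p = cons p (low-0 d) (solve 2 (λ x a → a := a :+ x :* con (+ 0)) refl x a)

    low-shift : ∀ {d y} → Low A x d y → Low A x (suc d) (x * y)
    low-shift l = cons 0∈ l (sym (+-identityˡ _))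

    low-+ : ∀ {d y z} → Low A x d y → Low A x d z → Low A x d (y + z)
    low-+ (nil e) (nil f) = nil (trans (+-cong e f) (+-identityˡ _))
    low-+ (cons {a = a} {q} p l e) (cons {a = b} {r} p′ l′ f) = cons (p +∈ p′) (low-+ l l′) (trans (+-cong e f)
      (solve 5 (λ x a q b r → (a :+ x :* q) :+ (b :+ x :* r) := (a :+ b) :+ x :* (q :+ r)) refl x a q b r))

    low-scale : ∀ {d y a} → A a → Low A x d y → Low A x d (a * y)
    low-scale p (nil e) = nil (trans (*-congˡ e) (zeroʳ _))
    low-scale {a = a} p (cons {a = b} {q} p′ l e) = cons (p *∈ p′) (low-scale p l) (trans (*-congˡ e)
      (solve 4 (λ x a b q → a :* (b :+ x :* q) := a :* b :+ x :* (a :* q)) refl x a b q))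

    low-neg : ∀ {d y} → Low A x d y → Low A x d (- y)
    low-neg {y = y} l = low-resp (solve 1 (λ y → con (ℤ.- (+ 1)) :* y := :- y) refl y) (low-scale (ι∈ (ℤ.- (+ 1))) l)

    low-weaken : ∀ {d y} → Low A x d y → Low A x (suc d) y
    low-weaken (nil e)      = low-resp (sym e) (low-0 1)
    low-weaken (cons p l e) = cons p (low-weaken l) e

    low-weaken-+ : ∀ k {d y} → Low A x d y → Low A x (k ℕ.+ d) y
    low-weaken-+ zero    l = l
    low-weaken-+ (suc k) l = low-weaken (low-weaken-+ k l)

    low-* : ∀ {d e y z} → Low A x d y → Low A x e z → Low A x (d ℕ.+ e) (y * z)
    low-* {e = e} (nil y≈0) l = low-resp (sym (trans (*-congʳ y≈0) (zeroˡ _))) (low-0 e)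
    low-* {suc d} {z = z} (cons {a = a} {q} p l y≈) m = low-resp
      (trans (solve 4 (λ x a q z → a :* z :+ x :* (q :* z) := (a :+ x :* q) :* z) refl x a q z) (*-congʳ (sym y≈)))
      (low-+ (low-weaken-+ (suc d) (low-scale p m)) (low-shift (low-* l m)))

    low-shift-^ : ∀ k {d y} → Low A x d y → Low A x (k ℕ.+ d) (x ^ k * y)
    low-shift-^ zero    l = low-resp (sym (*-identityˡ _)) l
    low-shift-^ (suc k) l = low-resp (sym (*-assoc _ _ _)) (low-shift (low-shift-^ k l))

    low-power : ∀ {k d} → k ℕ.< d → Low A x d (x ^ k)
    low-power {zero}  (ℕ.s≤s _)   = low-const 1∈
    low-power {suc k} (ℕ.s≤s k<d) = low-shift (low-power k<d)

    low-unsnoc : ∀ {d y} → Low A x (suc d) y → ∃[ a ] ∃[ l ] (A a × Low A x d l × y ≈ l + a * x ^ d)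
    low-unsnoc {y = y} (cons {a = a} {q} p (nil q≈0) y≈) = a , 0# , p , nil refl , trans y≈ (trans (+-congˡ (*-congˡ q≈0))
      (solve 2 (λ x a → a :+ x :* con (+ 0) := con (+ 0) :+ a :* x :^ 0) refl x a))
    low-unsnoc {suc d} (cons {a = a} p l@(cons _ _ _) y≈) with b , r , p′ , l′ , q≈ ← low-unsnoc l =
      b , a + x * r , p′ , cons p l′ refl , trans y≈ (trans (+-congˡ (*-congˡ q≈))
      (solve 5 (λ x a b r w → a :+ x :* (r :+ b :* w) := (a :+ x :* r) :+ b :* (x :* w)) refl x a b r (x ^ d)))

    -- Multiplication by x raises the degree bound by one; the new top term is a multiple of x ^ d,
    -- and the monic equation lowers it again.
    integral-powers : ∀ {d} → Low A x d (x ^ d) → ∀ k → Low A x d (x ^ k)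
    integral-powers {zero}  l zero    = l
    integral-powers {suc d} l zero    = low-const 1∈
    integral-powers {d}     l (suc k) with a , r , p , l′ , e ← low-unsnoc (low-shift (integral-powers l k)) =
      low-resp (sym e) (low-+ l′ (low-scale p l))

    evalMonic-low : ∀ p → ∃[ l ] (Low A x (length p) l × evalMonic K p x ≈ x ^ length p + l)
    evalMonic-low []       = 0# , nil refl , sym (+-identityʳ 1#)
    evalMonic-low (a ∷ as) with l , low , e ← evalMonic-low as =
      ι a + x * l , cons (ι∈ a) low refl , trans (+-congˡ (*-congˡ e))
      (solve 4 (λ x a w l → a :+ x :* (w :+ l) := x :* w :+ (a :+ x :* l)) refl x (ι a) (x ^ length as) l)

    integral⇒integralOver : Integral K x → IntegralOver A x
    integral⇒integralOver (p , root) with l , low , e ← evalMonic-low p =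
      length p , low-resp
        (≈-modulo (ι (ℤ.- (+ 1))) (solve 2 (λ w l → :- l := w :+ con (ℤ.- (+ 1)) :* ((w :+ l) :- con (+ 0))) refl (x ^ length p) l)
        (trans (sym e) root)) (low-neg low)

    -- A term a xⁱ with i < d, multiplied by n ^ d, becomes a n^(d - i) (n x)ⁱ.
    clear-denominators : ∀ {n d y} → A n → A (n * x) → Low A x d y → A (n ^ d * y)
    clear-denominators p q (nil e) = resp (sym (trans (*-congˡ e) (zeroʳ _))) 0∈
    clear-denominators {n} {suc d} p q (cons {a = a} {r} p′ l e) = resp
      (trans (solve 5 (λ n w a x r → n :* w :* a :+ n :* x :* (w :* r) := n :* w :* (a :+ x :* r)) refl n (n ^ d) a x r) (*-congˡ (sym e)))
      (^∈ (suc d) p *∈ p′ +∈ q *∈ clear-denominators p q l)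


-- Orders in K, and ℤ as the first example.

module Orders {c ℓ₁ ℓ₂} (K : HeytingField c ℓ₁ ℓ₂)
  (discrete : Decidable (HeytingField._#_ K))
  (characteristicZero : ∀ k → HeytingField._≈_ K (fromℕ K k) (HeytingField.0# K) → k ≡ 0)
  where

  open Subrings K public
  open HeytingField K using (_#_; tight; #⇒invertible)

  1≉0 : ¬ 1# ≈ 0#
  1≉0 1≈0 = proj₂ (tight _ _) 1≈0 (HeytingCommutativeRingProperties.1#0 (HeytingField.heytingCommutativeRing K))

  ≈0? : ∀ x → Dec (x ≈ 0#)
  ≈0? x with discrete x 0#
  ... | yes x#0 = no λ x≈0 → proj₂ (tight _ _) x≈0 x#0
  ... | no ¬x#0 = yes (proj₁ (tight _ _) ¬x#0)

  inverse : ∀ {x} → ¬ x ≈ 0# → ∃[ y ] x * y ≈ 1#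
  inverse {x} x≉0 with discrete x 0#
  ... | no ¬x#0 = contradiction (proj₁ (tight _ _) ¬x#0) x≉0
  ... | yes x#0 with y , _ , e ← #⇒invertible x#0 =
    y , trans (solve 2 (λ x y → x :* y := (x :- con (+ 0)) :* y) refl x y) e

  *-cancelˡ-0 : ∀ {x y} → ¬ x ≈ 0# → x * y ≈ 0# → y ≈ 0#
  *-cancelˡ-0 {x} {y} x≉0 xy≈0 with z , e ← inverse x≉0 = ≈-modulo (- y)
    (trans (solve 3 (λ x y z → y := z :* (x :* y) :+ :- y :* (x :* z :- x :^ 0)) refl x y z)
      (+-congʳ (trans (*-congˡ xy≈0) (zeroʳ _)))) e

  *-cancelˡ : ∀ {x y z} → ¬ x ≈ 0# → x * y ≈ x * z → y ≈ z
  *-cancelˡ {x} {y} {z} x≉0 e = ≈-modulo 1#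
    (solve 2 (λ y z → y := z :+ y :^ 0 :* ((y :- z) :- con (+ 0))) refl y z)
    (*-cancelˡ-0 x≉0 (≈-modulo 1# (solve 3 (λ x y z → x :* (y :- z) := con (+ 0) :+ x :^ 0 :* (x :* y :- x :* z)) refl x y z) e))

  fromℕ≉0 : ∀ n → .{{NonZero n}} → ¬ fromℕ K n ≈ 0#
  fromℕ≉0 (suc n) e with () ← characteristicZero (suc n) e

  2≉0 : ¬ 2# ≈ 0#
  2≉0 = fromℕ≉0 2

  fromℕ-^ : ∀ n k → fromℕ K (n ℕ.^ k) ≈ fromℕ K n ^ k
  fromℕ-^ n zero    = ι-1
  fromℕ-^ n (suc k) = trans (×1-homo-* n (n ℕ.^ k)) (*-congˡ (fromℕ-^ n k))

  -- These properties hold for ℤ and pass to quadratic extensions. `norm` supplies denominators for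
  -- inverses, and `residuesFinite` feeds the pigeonhole principle. Its map into `Fin M` may depend
  -- on the membership proof; only equal values have to imply congruence modulo N.
  record IsOrder {p} (A : Carrier → Set p) : Set (c ⊔ ℓ₁ ⊔ p) where
    field
      isSubring      : IsSubring A
      norm           : ∀ {x} → A x → ¬ x ≈ 0# → ∃[ y ] ∃[ N ] (NonZero N × A y × x * y ≈ fromℕ K N)
      frobenius²     : ∀ {x} → A x → Even A (x ^ 4 - x)
      residuesFinite : ∀ N → .{{NonZero N}} → ∃[ M ] Σ[ f ∈ (∀ {x} → A x → Fin M) ]
        (∀ {x y} (p : A x) (q : A y) → f p ≡ f q → ∃[ z ] (A z × x - y ≈ fromℕ K N * z))
      integral       : ∀ {x} → IntegralOver A x → Integral K x
    open IsSubring isSubring public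
    open Parity isSubring public

  IsInteger : Carrier → Set ℓ₁
  IsInteger x = ∃[ i ] x ≈ ι i

  integers-subring : IsSubring IsInteger
  integers-subring = record
    { resp = λ x≈y (i , e) → i , trans (sym x≈y) e
    ; _+∈_ = λ (i , e) (j , f) → i ℤ.+ j , trans (+-cong e f) (sym (ι-+ i j))
    ; _*∈_ = λ (i , e) (j , f) → i ℤ.* j , trans (*-cong e f) (sym (ι-* i j))
    ; -∈_  = λ (i , e) → ℤ.- i , trans (-‿cong e) (sym (ι-neg i))
    ; 1∈   = + 1 , sym ι-1
    }

  fromℕ²-even : ∀ n → Even IsInteger (fromℕ K n * fromℕ K n - fromℕ K n)
  fromℕ²-even zero    = 0# , IsSubring.0∈ integers-subring , solve 0 (con (+ 0) :* con (+ 0) :- con (+ 0) := con (+ 2) :* con (+ 0)) refl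
  fromℕ²-even (suc n) = even-resp
    (solve 1 (λ n → (n :* n :- n) :+ con (+ 2) :* n := (n :^ 0 :+ n) :* (n :^ 0 :+ n) :- (n :^ 0 :+ n)) refl (fromℕ K n))
    (even-+ (fromℕ²-even n) (2*-even (+ n , refl)))
    where open Parity integers-subring

  ι²-even : ∀ i → Even IsInteger (ι i * ι i - ι i)
  ι²-even (+ n)    = fromℕ²-even n
  ι²-even -[1+ n ] = even-resp
    (solve 1 (λ m → (m :* m :- m) :+ con (+ 2) :* m := :- m :* :- m :- :- m) refl (fromℕ K (suc n)))
    (even-+ (fromℕ²-even (suc n)) (2*-even (+ suc n , refl)))
    where open Parity integers-subring

  -- `evalMonic` keeps all terms on one side, so the coefficients of y change sign.
  low-integers⇒evalMonic : ∀ {x d y} → Low IsInteger x d y → ∃[ p ] evalMonic K p x ≈ x ^ d - y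
  low-integers⇒evalMonic {x} (nil e) = [] , trans (solve 1 (λ x → x :^ 0 := x :^ 0 :- con (+ 0)) refl x) (+-congˡ (-‿cong (sym e)))
  low-integers⇒evalMonic {x} {suc d} (cons {a = a} {q} (i , a≈) l e) with p , f ← low-integers⇒evalMonic l =
    ℤ.- i ∷ p , trans (+-cong (trans (ι-neg i) (-‿cong (sym a≈))) (*-congˡ f))
      (trans (solve 4 (λ x a q w → :- a :+ x :* (w :- q) := x :* w :- (a :+ x :* q)) refl x a q (x ^ d)) (+-congˡ (-‿cong (sym e))))

  integers-order : IsOrder IsInteger
  integers-order = record
    { isSubring      = integers-subring
    ; norm           = norm
    ; frobenius²     = λ {x} (i , e) → even-resp
        (trans (solve 1 (λ x → (x :* x :+ x :+ x :^ 0) :* (x :* x :- x) := x :^ 4 :- x) refl (ι i)) (+-cong (^-congˡ 4 (sym e)) (-‿cong (sym e))))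
        (even-* (ι∈ i *∈ ι∈ i +∈ ι∈ i +∈ 1∈) (ι²-even i))
    ; residuesFinite = λ N → N , (λ (i , _) → fromℕ< (n%ℕd<d i N)) , λ (i , e) (j , f) eq →
        congruent N {i = i} {j} e f (Fin.fromℕ<-injective _ _ _ _ eq)
    ; integral       = λ {x} (d , l) → let p , e = low-integers⇒evalMonic l in p , trans e (-‿inverseʳ _)
    }
    where
    open IsSubring integers-subring
    open Parity integers-subring

    norm : ∀ {x} → IsInteger x → ¬ x ≈ 0# → ∃[ y ] ∃[ N ] (NonZero N × IsInteger y × x * y ≈ fromℕ K N)
    norm (+ zero , e)    x≉0 = contradiction e x≉0
    norm (+ suc n , e)   x≉0 = 1# , suc n , _ , 1∈ , trans (*-identityʳ _) e
    norm (-[1+ n ] , e)  x≉0 = - 1# , suc n , _ , -∈ 1∈ ,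
      trans (*-congʳ e) (solve 1 (λ m → :- m :* :- (m :^ 0) := m) refl (fromℕ K (suc n)))

    congruent : ∀ N → .{{_ : NonZero N}} → ∀ {x y i j} → x ≈ ι i → y ≈ ι j → i ℤ.%ℕ N ≡ j ℤ.%ℕ N →
      ∃[ z ] (IsInteger z × x - y ≈ fromℕ K N * z)
    congruent N {i = i} {j} e f eq = ι q - ι q′ , ι∈ q -∈ ι∈ q′ , trans (+-cong (expand i e) (-‿cong (expand j f)))
      (trans (+-congʳ (+-congʳ (reflexive (≡.cong (fromℕ K) eq))))
      (solve 4 (λ r N q q′ → r :+ q :* N :- (r :+ q′ :* N) := N :* (q :- q′)) refl (fromℕ K (j ℤ.%ℕ N)) (fromℕ K N) (ι q) (ι q′)))
      where
      q = i ℤ./ℕ N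
      q′ = j ℤ./ℕ N
      expand : ∀ {x} i → x ≈ ι i → x ≈ fromℕ K (i ℤ.%ℕ N) + ι (i ℤ./ℕ N) * fromℕ K N
      expand i e = trans e (trans (reflexive (≡.cong ι (a≡a%ℕn+[a/ℕn]*n i N)))
        (trans (ι-+ (+ (i ℤ.%ℕ N)) (i ℤ./ℕ N ℤ.* + N)) (+-congˡ (ι-* (i ℤ./ℕ N) (+ N)))))


-- Adjoining a root θ of X² - X + γ to an order.

module QuadraticExtension {c ℓ₁ ℓ₂} (K : HeytingField c ℓ₁ ℓ₂)
  (discrete : Decidable (HeytingField._#_ K))
  (characteristicZero : ∀ k → HeytingField._≈_ K (fromℕ K k) (HeytingField.0# K) → k ≡ 0)
  where

  open Orders K discrete characteristicZero

  -- The coefficients a and b may fail to be unique: for n = 1 the second root adjoined is 0 or 1.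
  -- Nothing below compares coefficients.
  Adjoin : ∀ {p} → (Carrier → Set p) → Carrier → Carrier → Set (c ⊔ ℓ₁ ⊔ p)
  Adjoin A θ x = ∃[ a ] ∃[ b ] (A a × A b × x ≈ a + b * θ)

  module _ {p} {A : Carrier → Set p} (order : IsOrder A) (γ : ℤ) {θ : Carrier}
    (θ²≈θ-γ : θ * θ ≈ θ - ι γ) (2θ-1≉0 : ¬ 2# * θ - 1# ≈ 0#) where

    open IsOrder order

    private
      g : Carrier
      g = ι γ

    extend : ∀ {a} → A a → Adjoin A θ a
    extend {a} p = a , 0# , p , 0∈ , solve 2 (λ a θ → a := a :+ con (+ 0) :* θ) refl a θ

    generator : Adjoin A θ θ
    generator = 0# , 1# , 0∈ , 1∈ , solve 1 (λ θ → θ := con (+ 0) :+ θ :^ 0 :* θ) refl θ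

    product : ∀ {x y a b a′ b′} → x ≈ a + b * θ → y ≈ a′ + b′ * θ →
      x * y ≈ (a * a′ - g * (b * b′)) + (a * b′ + a′ * b + b * b′) * θ
    product {a = a} {b} {a′} {b′} e f = trans (*-cong e f) (≈-modulo (b * b′)
      (solve 6 (λ a b a′ b′ g θ → (a :+ b :* θ) :* (a′ :+ b′ :* θ) :=
        ((a :* a′ :- g :* (b :* b′)) :+ (a :* b′ :+ a′ :* b :+ b :* b′) :* θ) :+ b :* b′ :* (θ :* θ :- (θ :- g)))
        refl a b a′ b′ g θ) θ²≈θ-γ)

    adjoin-subring : IsSubring (Adjoin A θ)
    adjoin-subring = record
      { resp = λ x≈y (a , b , p , q , e) → a , b , p , q , trans (sym x≈y) e
      ; _+∈_ = λ (a , b , p , q , e) (a′ , b′ , p′ , q′ , e′) → a + a′ , b + b′ , p +∈ p′ , q +∈ q′ ,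
          trans (+-cong e e′) (solve 5 (λ a b a′ b′ θ → (a :+ b :* θ) :+ (a′ :+ b′ :* θ) := (a :+ a′) :+ (b :+ b′) :* θ) refl a b a′ b′ θ)
      ; _*∈_ = λ (a , b , p , q , e) (a′ , b′ , p′ , q′ , e′) → _ , _ ,
          p *∈ p′ -∈ ι∈ γ *∈ (q *∈ q′) , p *∈ q′ +∈ p′ *∈ q +∈ q *∈ q′ , product e e′
      ; -∈_  = λ (a , b , p , q , e) → - a , - b , -∈ p , -∈ q ,
          trans (-‿cong e) (solve 3 (λ a b θ → :- (a :+ b :* θ) := :- a :+ :- b :* θ) refl a b θ)
      ; 1∈   = extend 1∈
      }

    private
      module A[θ] = IsSubring adjoin-subring
      module E = Parity adjoin-subring

    extend-even : ∀ {x} → Even A x → Even (Adjoin A θ) x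
    extend-even (z , p , e) = z , extend p , e

    -- The conjugation θ ↦ 1 - θ sends x to x̄, and x x̄ = a² + a b + γ b² lies in `A`, where a
    -- further multiple is a positive integer.
    adjoin-norm : ∀ {x} → Adjoin A θ x → ¬ x ≈ 0# → ∃[ y ] ∃[ N ] (NonZero N × Adjoin A θ y × x * y ≈ fromℕ K N)
    adjoin-norm {x} (a , b , p , q , e) x≉0 = multiplier
      where
      x̄ = (a + b) - b * θ
      τ = 2# * θ - 1#

      x̄∈ : Adjoin A θ x̄
      x̄∈ = extend (p +∈ q) A[θ].-∈ extend q A[θ].*∈ generator

      τ∈ : Adjoin A θ τ
      τ∈ = A[θ].ι∈ (+ 2) A[θ].*∈ generator A[θ].-∈ A[θ].1∈

      xx̄≈ : x * x̄ ≈ a * a + a * b + g * (b * b)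
      xx̄≈ = trans (*-congʳ e) (≈-modulo (- (b * b)) (solve 4 (λ a b g θ → (a :+ b :* θ) :* ((a :+ b) :- b :* θ) :=
        (a :* a :+ a :* b :+ g :* (b :* b)) :+ :- (b :* b) :* (θ :* θ :- (θ :- g))) refl a b g θ) θ²≈θ-γ)

      descend : ∀ {y v} → Adjoin A θ y → A v → x * y ≈ v → ¬ x * y ≈ 0# →
        ∃[ y ] ∃[ N ] (NonZero N × Adjoin A θ y × x * y ≈ fromℕ K N)
      descend {y} {v} y∈ v∈ e xy≉0 with w , N , N≢0 , w∈ , f ← norm v∈ (λ v≈0 → xy≉0 (trans e v≈0)) =
        y * w , N , N≢0 , y∈ A[θ].*∈ extend w∈ , trans (sym (*-assoc x y w)) (trans (*-congʳ e) f)

      multiplier : ∃[ y ] ∃[ N ] (NonZero N × Adjoin A θ y × x * y ≈ fromℕ K N)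
      multiplier with ≈0? (x * x̄)
      ... | no xx̄≉0 = descend x̄∈ (p *∈ p +∈ p *∈ q +∈ ι∈ γ *∈ (q *∈ q)) xx̄≈ xx̄≉0
      -- If the conjugate x̄ vanishes then x = x - x̄ is the multiple b τ of τ, and τ² is an integer.
      ... | yes xx̄≈0 = descend τ∈ (q *∈ (1∈ -∈ ι∈ (+ 4) *∈ ι∈ γ))
        (trans (*-congʳ x≈bτ) (≈-modulo (ι (+ 4) * b)
          (solve 3 (λ b g θ → b :* (con (+ 2) :* θ :- θ :^ 0) :* (con (+ 2) :* θ :- θ :^ 0) :=
            b :* (θ :^ 0 :- con (+ 4) :* g) :+ con (+ 4) :* b :* (θ :* θ :- (θ :- g))) refl b g θ) θ²≈θ-γ))
        (λ xτ≈0 → 2θ-1≉0 (*-cancelˡ-0 x≉0 xτ≈0))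
        where
        x≈bτ : x ≈ b * τ
        x≈bτ = trans e (≈-modulo 1# (solve 3 (λ a b θ → a :+ b :* θ :=
          b :* (con (+ 2) :* θ :- θ :^ 0) :+ θ :^ 0 :* (((a :+ b) :- b :* θ) :- con (+ 0))) refl a b θ) (*-cancelˡ-0 x≉0 xx̄≈0))

    -- Modulo 2 squaring is additive and θ² ≡ θ + γ, so θ⁴ ≡ θ + γ + γ² ≡ θ. Hence (a + b θ)⁴ ≡ a⁴ +
    -- b⁴ θ ≡ a + b θ. The explicit even remainder comes from squaring twice by `product`.
    adjoin-frobenius² : ∀ {x} → Adjoin A θ x → Even (Adjoin A θ) (x ^ 4 - x)
    adjoin-frobenius² {x} (a , b , p , q , e) = E.even-resp (sym x⁴-x)
      (E.even-+ (extend-even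
          (even-+ (even-+ (frobenius² p) (even-* (b²∈ *∈ b²∈) γ²-γ))
            (2*-even (-∈ (ι∈ γ *∈ (p *∈ p *∈ b²∈)) -∈ ι∈ γ *∈ (ι∈ (+ 2) *∈ (p *∈ p *∈ b²∈) +∈ ι∈ (+ 2) *∈ (p *∈ (q *∈ b²∈)))))))
        (E.even-* generator (extend-even
          (even-+ (frobenius² q) (2*-even (P∈ *∈ Q∈ +∈ (ι∈ (+ 2) *∈ (p *∈ p *∈ b²∈) +∈ ι∈ (+ 2) *∈ (p *∈ (q *∈ b²∈)))))))))
      where
      b²∈ = q *∈ q
      P = a * a - g * (b * b)
      Q = a * b + a * b + b * b
      P∈ : A P
      P∈ = p *∈ p -∈ ι∈ γ *∈ b²∈
      Q∈ : A Q
      Q∈ = p *∈ q +∈ p *∈ q +∈ q *∈ q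
      γ²-γ : Even A (g * g - g)
      γ²-γ with z , (i , z≈i) , f ← ι²-even γ = z , resp (sym z≈i) (ι∈ i) , f
      x⁴-x : x ^ 4 - x ≈ ((a ^ 4 - a + b * b * (b * b) * (g * g - g)) +
          2# * (- (g * (a * a * (b * b))) - g * (2# * (a * a * (b * b)) + 2# * (a * (b * (b * b))))))
        + θ * ((b ^ 4 - b) + 2# * (P * Q + (2# * (a * a * (b * b)) + 2# * (a * (b * (b * b))))))
      x⁴-x = trans (+-cong (trans (solve 1 (λ x → x :^ 4 := x :* x :* (x :* x)) refl x) (product (product e e) (product e e))) (-‿cong e))
        (solve 4 (λ a b g θ →
          let P = a :* a :- g :* (b :* b)
              Q = a :* b :+ a :* b :+ b :* b
          in ((P :* P :- g :* (Q :* Q)) :+ (P :* Q :+ P :* Q :+ Q :* Q) :* θ) :- (a :+ b :* θ) :=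
            ((a :^ 4 :- a :+ b :* b :* (b :* b) :* (g :* g :- g)) :+
              con (+ 2) :* (:- (g :* (a :* a :* (b :* b))) :- g :* (con (+ 2) :* (a :* a :* (b :* b)) :+ con (+ 2) :* (a :* (b :* (b :* b))))))
            :+ θ :* ((b :^ 4 :- b) :+ con (+ 2) :* (P :* Q :+ (con (+ 2) :* (a :* a :* (b :* b)) :+ con (+ 2) :* (a :* (b :* (b :* b)))))))
          refl a b g θ)

    adjoin-residues : ∀ N → .{{_ : NonZero N}} → ∃[ M ] Σ[ f ∈ (∀ {x} → Adjoin A θ x → Fin M) ]
      (∀ {x y} (p : Adjoin A θ x) (q : Adjoin A θ y) → f p ≡ f q → ∃[ z ] (Adjoin A θ z × x - y ≈ fromℕ K N * z))
    adjoin-residues N with M , f , f-sep ← residuesFinite N = M ℕ.* M , (λ (_ , _ , p , q , _) → combine (f p) (f q)) , separates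
      where
      separates : ∀ {x y} (p : Adjoin A θ x) (q : Adjoin A θ y) → _ → ∃[ z ] (Adjoin A θ z × x - y ≈ fromℕ K N * z)
      separates (a , b , p , q , e) (a′ , b′ , p′ , q′ , e′) eq
        with i , j ← Fin.combine-injective (f p) (f q) (f p′) (f q′) eq
        with z , z∈ , h ← f-sep p p′ i | w , w∈ , k ← f-sep q q′ j =
        z + w * θ , (z , w , z∈ , w∈ , refl) , trans (+-cong e (-‿cong e′))
          (trans (solve 5 (λ a b a′ b′ θ → (a :+ b :* θ) :- (a′ :+ b′ :* θ) := (a :- a′) :+ (b :- b′) :* θ) refl a b a′ b′ θ)
          (trans (+-cong h (*-congʳ k)) (solve 4 (λ n z w θ → n :* z :+ n :* w :* θ := n :* (z :+ w :* θ)) refl (fromℕ K N) z w θ)))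

    split-low : ∀ {x d y} → Low (Adjoin A θ) x d y → ∃[ f ] ∃[ h ] (Low A x d f × Low A x d h × y ≈ f + h * θ)
    split-low (nil e) = 0# , 0# , nil refl , nil refl , trans e (solve 1 (λ θ → con (+ 0) := con (+ 0) :+ con (+ 0) :* θ) refl θ)
    split-low {x} (cons (a , b , p , q , e) l y≈) with f , h , lf , lh , e′ ← split-low l =
      a + x * f , b + x * h , cons p lf refl , cons q lh refl , trans y≈ (trans (+-cong e (*-congˡ e′))
        (solve 6 (λ x a b f h θ → (a :+ b :* θ) :+ x :* (f :+ h :* θ) := (a :+ x :* f) :+ (b :+ x :* h) :* θ) refl x a b f h θ))

    -- A root of the monic polynomial u - h θ is a root of its norm (u - h θ) (u - h θ̄) = u² - u h + γ h².
    adjoin-integralOver : ∀ {x} → IntegralOver (Adjoin A θ) x → IntegralOver A x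
    adjoin-integralOver {x} (d , l) with f , h , lf , lh , e ← split-low l = d ℕ.+ d , low-resp (sym x²ᵈ≈)
      (low-+ (low-+ (low-+ (low-scale (ι∈ (+ 2)) (low-shift-^ d lf)) (low-neg (low-* lf lf))) (low-+ (low-shift-^ d lh) (low-neg (low-* lf lh))))
        (low-neg (low-scale (ι∈ γ) (low-* lh lh))))
      where
      open LowDegree isSubring
      w = x ^ d
      u≈ : w - f - h * θ ≈ 0#
      u≈ = ≈-modulo 1# (solve 4 (λ w f h θ → w :- f :- h :* θ := con (+ 0) :+ w :^ 0 :* (w :- (f :+ h :* θ))) refl w f h θ) e
      x²ᵈ≈ : x ^ (d ℕ.+ d) ≈ 2# * (w * f) + - (f * f) + (w * h + - (f * h)) + - (g * (h * h))
      -- The first cofactor is the conjugate of the vanishing factor, w - f - h (1 - θ).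
      x²ᵈ≈ = trans (^-homo-* x d d) (≈-modulo (w - f - h + h * θ)
        (≈-modulo (h * h) (solve 5 (λ w f h g θ → w :* w :=
          (con (+ 2) :* (w :* f) :+ :- (f :* f) :+ (w :* h :+ :- (f :* h)) :+ :- (g :* (h :* h)))
          :+ (w :- f :- h :+ h :* θ) :* ((w :- f :- h :* θ) :- con (+ 0)) :+ h :* h :* (θ :* θ :- (θ :- g))) refl w f h g θ) θ²≈θ-γ) u≈)

    adjoin-order : IsOrder (Adjoin A θ)
    adjoin-order = record
      { isSubring      = adjoin-subring
      ; norm           = adjoin-norm
      ; frobenius²     = adjoin-frobenius²
      ; residuesFinite = adjoin-residues
      ; integral       = λ i → integral (adjoin-integralOver i)
      }


-- Common denominators of powers, and their reduction to odd ones.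

even⊎odd : ∀ n → ∃[ k ] (n ≡ k ℕ.+ k ⊎ n ≡ suc (k ℕ.+ k))
even⊎odd zero = 0 , inj₁ ≡.refl
even⊎odd (suc n) with even⊎odd n
... | k , inj₁ e = k , inj₂ (≡.cong suc e)
... | k , inj₂ e = suc k , inj₁ (≡.trans (≡.cong suc e) (≡.cong suc (≡.sym (ℕ.+-suc k k))))

module Denominators {c ℓ₁ ℓ₂} (K : HeytingField c ℓ₁ ℓ₂)
  (discrete : Decidable (HeytingField._#_ K))
  (characteristicZero : ∀ k → HeytingField._≈_ K (fromℕ K k) (HeytingField.0# K) → k ≡ 0)
  where

  open Orders K discrete characteristicZero

  fromℕ-double : ∀ k → fromℕ K (k ℕ.+ k) ≈ 2# * fromℕ K k
  fromℕ-double k = trans (×-homo-+ 1# k k) (solve 1 (λ k → k :+ k := con (+ 2) :* k) refl (fromℕ K k))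

  -- A monic polynomial of degree d at 1/2, multiplied by 2^d, is 1 plus an even integer: only the
  -- leading term is left without a factor 2.
  half-not-integral : ∀ {h} → 2# * h ≈ 1# → ¬ Integral K h
  half-not-integral {h} 2h≈1 (p , root) = let i , e = odd-numerator p in
    contradiction-at i (trans (sym e) (trans (*-congˡ root) (zeroʳ _)))
    where
    odd-numerator : ∀ p → ∃[ i ] 2# ^ length p * evalMonic K p h ≈ 1# + 2# * ι i
    odd-numerator [] = + 0 , solve 1 (λ h → h :^ 0 :* h :^ 0 := h :^ 0 :+ con (+ 2) :* con (+ 0)) refl h
    odd-numerator (a ∷ as) with i , e ← odd-numerator as
                           with j , f ← IsSubring.^∈ integers-subring (length as) (+ 2 , refl) =
      j ℤ.* a ℤ.+ i , trans (≈-modulo (w * evalMonic K as h)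
        (solve 4 (λ w a h v → con (+ 2) :* w :* (a :+ h :* v) := (con (+ 2) :* (w :* a) :+ w :* v) :+ w :* v :* (con (+ 2) :* h :- w :^ 0))
          refl w (ι a) h (evalMonic K as h)) 2h≈1)
        (trans (+-cong (*-congˡ (*-congʳ f)) e)
        (trans (solve 3 (λ j a i → con (+ 2) :* (j :* a) :+ (j :^ 0 :+ con (+ 2) :* i) := j :^ 0 :+ con (+ 2) :* (j :* a :+ i)) refl (ι j) (ι a) (ι i))
          (+-congˡ (*-congˡ (sym (trans (ι-+ (j ℤ.* a) i) (+-congʳ (ι-* j a))))))))
      where w = 2# ^ length as
    odd≢0 : ∀ k → ¬ fromℕ K (suc (k ℕ.+ k)) ≈ 0#
    odd≢0 k = fromℕ≉0 (suc (k ℕ.+ k))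
    contradiction-at : ∀ i → ¬ 1# + 2# * ι i ≈ 0#
    contradiction-at (+ k)    e = odd≢0 k (trans (+-congˡ (fromℕ-double k)) e)
    -- 1 - 2 (1 + k) = - (1 + 2k) reduces the negative case to the positive one.
    contradiction-at -[1+ k ] e = odd≢0 k (trans (+-congˡ (fromℕ-double k)) (≈-modulo (- 1#)
      (solve 1 (λ k → k :^ 0 :+ con (+ 2) :* k := con (+ 0) :+ :- (k :^ 0) :* ((k :^ 0 :+ con (+ 2) :* :- (k :^ 0 :+ k)) :- con (+ 0))) refl (fromℕ K k)) e))

  Fractions : ∀ {p} → (Carrier → Set p) → Set (c ⊔ p)
  Fractions A = ∀ x → ∃[ N ] (NonZero N × A (fromℕ K N * x))

  AlmostIntegral : ∀ {p} → (Carrier → Set p) → Carrier → Set p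
  AlmostIntegral A x = ∃[ N ] (NonZero N × ∀ k → A (fromℕ K N * x ^ k))

  module _ {p} {A : Carrier → Set p} (order : IsOrder A) where

    open IsOrder order
    open LowDegree isSubring

    -- All powers of x are polynomials in x of degree below d, so one d-th power of a denominator of
    -- x serves them all.
    integral⇒almostIntegral : Fractions A → ∀ {x} → Integral K x → AlmostIntegral A x
    integral⇒almostIntegral fractions {x} i with d , l ← integral⇒integralOver i | N , N≢0 , Nx∈ ← fractions x =
      N ℕ.^ d , ℕ.m^n≢0 N d {{N≢0}} , λ k →
        resp (*-congʳ (sym (fromℕ-^ N d))) (clear-denominators (fromℕ∈ N) Nx∈ (integral-powers l k))

    -- Among the N xᵏ two are congruent modulo N, and then xʲ - xⁱ lies in A.
    almostIntegral⇒integral : ∀ {x} → AlmostIntegral A x → Integral K x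
    almostIntegral⇒integral {x} (N , N≢0 , multiples)
      with M , f , separates ← residuesFinite N {{N≢0}}
      with i , j , i<j , fi≡fj ← Fin.pigeonhole (ℕ.n<1+n M) (λ k → f (multiples (toℕ k)))
      with z , z∈ , e ← separates (multiples (toℕ i)) (multiples (toℕ j)) fi≡fj =
      integral (toℕ j , low-resp (sym xʲ≈) (low-+ (low-power i<j) (low-neg (constant i<j z∈))))
      where
      constant : ∀ {k d a} → k ℕ.< d → A a → Low A x d a
      constant (ℕ.s≤s _) = low-const
      xʲ≈ : x ^ toℕ j ≈ x ^ toℕ i - z
      xʲ≈ = ≈-modulo (- 1#) (solve 3 (λ u v z → v := (u :- z) :+ :- (u :^ 0) :* ((u :- v) :- z)) refl (x ^ toℕ i) (x ^ toℕ j) z)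
        (*-cancelˡ (fromℕ≉0 N {{N≢0}}) (trans (solve 3 (λ n u v → n :* (u :- v) := n :* u :- n :* v) refl (fromℕ K N) (x ^ toℕ i) (x ^ toℕ j)) e))

    -- If N is even, then w = N xᵏ has w² = N (N x²ᵏ) ∈ 2A, so w ∈ 2A and N/2 is a denominator as well.
    odd-denominator : ∀ {x} → AlmostIntegral A x → ∃[ e ] (∀ k → A (fromℕ K (suc (e ℕ.+ e)) * x ^ k))
    odd-denominator {x} (N , N≢0 , multiples) = <-rec _ step N N≢0 multiples
      where
      step : ∀ N → (∀ {M} → M ℕ.< N → NonZero M → (∀ k → A (fromℕ K M * x ^ k)) → _) →
        NonZero N → (∀ k → A (fromℕ K N * x ^ k)) → ∃[ e ] (∀ k → A (fromℕ K (suc (e ℕ.+ e)) * x ^ k))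
      step N rec N≢0 multiples with even⊎odd N
      ... | e     , inj₂ ≡.refl = e , multiples
      ... | suc e , inj₁ ≡.refl = rec (ℕ.m<m+n (suc e) ℕ.z<s) _ halved
        where
        n = fromℕ K (suc e)
        halved : ∀ k → A (n * x ^ k)
        halved k with z , z∈ , w≈2z ← even-root (multiples k) (frobenius² (multiples k)) (even-resp
          (trans (solve 3 (λ n m u → con (+ 2) :* (n :* (m :* (u :* u))) := (con (+ 2) :* n) :* u :* (m :* u)) refl n (fromℕ K (suc e ℕ.+ suc e)) (x ^ k))
            (*-congʳ (*-congʳ (sym (fromℕ-double (suc e))))))
          (2*-even (fromℕ∈ (suc e) *∈ resp (*-congˡ (^-homo-* x k k)) (multiples (k ℕ.+ k))))) =
          resp (sym (*-cancelˡ 2≉0 (trans (trans (sym (*-assoc _ _ _)) (*-congʳ (sym (fromℕ-double (suc e))))) w≈2z))) z∈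

    contained : ∀ {x} → A x → AlmostIntegral A x
    contained x∈ = 1 , _ , λ k → fromℕ∈ 1 *∈ ^∈ k x∈

    almostIntegral-subring : IsSubring (AlmostIntegral A)
    almostIntegral-subring = record
      { resp = λ x≈y (N , N≢0 , u) → N , N≢0 , λ k → resp (*-congˡ (^-congˡ k x≈y)) (u k)
      ; _+∈_ = sum∈
      ; _*∈_ = product∈
      ; -∈_  = λ {x} x∈ → resp-almost (solve 1 (λ x → :- (x :^ 0) :* x := :- x) refl x) (product∈ (contained (-∈ 1∈)) x∈)
      ; 1∈   = contained 1∈
      }
      where
      resp-almost : ∀ {x y} → x ≈ y → AlmostIntegral A x → AlmostIntegral A y
      resp-almost x≈y (N , N≢0 , u) = N , N≢0 , λ k → resp (*-congˡ (^-congˡ k x≈y)) (u k)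

      product∈ : ∀ {x y} → AlmostIntegral A x → AlmostIntegral A y → AlmostIntegral A (x * y)
      product∈ {x} {y} (N , N≢0 , u) (M , M≢0 , v) = N ℕ.* M , ℕ.m*n≢0 N M {{N≢0}} {{M≢0}} , λ k → resp
        (trans (solve 4 (λ n m x y → n :* x :* (m :* y) := n :* m :* (x :* y)) refl (fromℕ K N) (fromℕ K M) (x ^ k) (y ^ k))
          (*-cong (sym (×1-homo-* N M)) (sym (^-distrib-* x y k))))
        (u k *∈ v k)

      sum∈ : ∀ {x y} → AlmostIntegral A x → AlmostIntegral A y → AlmostIntegral A (x + y)
      sum∈ {x} {y} (N , N≢0 , u) (M , M≢0 , v) = N ℕ.* M , ℕ.m*n≢0 N M {{N≢0}} {{M≢0}} , λ k → resp
        (trans (solve 4 (λ n m x w → n :* x :^ 0 :* (m :* x :^ 0) :* w := n :* m :* w) refl (fromℕ K N) (fromℕ K M) x ((x + y) ^ k))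
          (*-congʳ (sym (×1-homo-* N M))))
        (mixed k 0 0)
        where
        -- Carrying a monomial xⁱ yʲ along, each step splits off one factor x + y; this replaces the
        -- binomial expansion of (x + y) ^ k.
        mixed : ∀ k i j → A (fromℕ K N * x ^ i * (fromℕ K M * y ^ j) * (x + y) ^ k)
        mixed zero    i j = u i *∈ v j *∈ 1∈
        mixed (suc k) i j = resp
          (solve 7 (λ n m x y a b w → n :* (x :* a) :* (m :* b) :* w :+ n :* a :* (m :* (y :* b)) :* w := n :* a :* (m :* b) :* ((x :+ y) :* w))
            refl (fromℕ K N) (fromℕ K M) x y (x ^ i) (y ^ j) ((x + y) ^ k))
          (mixed k (suc i) j +∈ mixed k i (suc j))

    -- For an odd denominator D = 1 + 2e, the element D x lies in `A` and is congruent to x modulo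
    -- 2, so the congruence for D x carries over to x.
    almostIntegral-frobenius² : ∀ {x} → AlmostIntegral A x → Even (AlmostIntegral A) (x ^ 4 - x)
    almostIntegral-frobenius² {x} x∈ with e , multiples ← odd-denominator x∈ = 𝒪₂.even-resp
      (trans (+-congʳ (+-cong (^-congˡ 4 D≈) (-‿cong D≈)))
        -- The coefficients 4, 12, 16, 8 are those of ((1 + 2e)⁴ - 1) / 2.
        (solve 2 (λ x e → ((((x :^ 0 :+ con (+ 2) :* e) :* x) :^ 4 :- (x :^ 0 :+ con (+ 2) :* e) :* x) :+
          con (+ 2) :* (e :* x :- (con (+ 4) :* e :+ con (+ 12) :* (e :* e) :+ con (+ 16) :* (e :* e :* e) :+ con (+ 8) :* (e :* e :* e :* e)) :* x :^ 4))
          := x :^ 4 :- x) refl x E))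
      (𝒪₂.even-+ (contained-even (frobenius² (multiples 1)))
        (𝒪₂.2*-even (E∈ 𝒪.*∈ x∈ 𝒪.-∈ (𝒪.ι∈ (+ 4) 𝒪.*∈ E∈ 𝒪.+∈ 𝒪.ι∈ (+ 12) 𝒪.*∈ (E∈ 𝒪.*∈ E∈)
          𝒪.+∈ 𝒪.ι∈ (+ 16) 𝒪.*∈ (E∈ 𝒪.*∈ E∈ 𝒪.*∈ E∈)
          𝒪.+∈ 𝒪.ι∈ (+ 8) 𝒪.*∈ (E∈ 𝒪.*∈ E∈ 𝒪.*∈ E∈ 𝒪.*∈ E∈)) 𝒪.*∈ 𝒪.^∈ 4 x∈)))
      where
      module 𝒪 = IsSubring almostIntegral-subring
      module 𝒪₂ = Parity almostIntegral-subring
      E = fromℕ K e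
      E∈ = 𝒪.fromℕ∈ e
      D≈ : fromℕ K (suc (e ℕ.+ e)) * x ^ 1 ≈ (1# + 2# * E) * x
      D≈ = *-cong (+-congˡ (fromℕ-double e)) (*-identityʳ x)
      contained-even : ∀ {y} → Even A y → Even (AlmostIntegral A) y
      contained-even (z , z∈ , f) = z , contained z∈ , f

  module _ {p} {A : Carrier → Set p} (order : IsOrder A) {α β : Carrier} (α∈ : A α) (β∈ : A β) where

    open IsOrder order

    trivial-denominator : ∀ {x} → A x → ∃[ N ] (NonZero N × A (fromℕ K N * x))
    trivial-denominator x∈ = 1 , _ , fromℕ∈ 1 *∈ x∈

    denominator : ∀ {x} → InSubfield K α β x → ∃[ N ] (NonZero N × A (fromℕ K N * x))
    denominator α-in  = trivial-denominator α∈
    denominator β-in  = trivial-denominator β∈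
    denominator 0#-in = trivial-denominator 0∈
    denominator 1#-in = trivial-denominator 1∈
    denominator (+-in {x} {y} p q) with N , N≢0 , u ← denominator p | M , M≢0 , v ← denominator q =
      N ℕ.* M , ℕ.m*n≢0 N M {{N≢0}} {{M≢0}} , resp
        (trans (solve 4 (λ n m x y → m :* (n :* x) :+ n :* (m :* y) := n :* m :* (x :+ y)) refl (fromℕ K N) (fromℕ K M) x y) (*-congʳ (sym (×1-homo-* N M))))
        (fromℕ∈ M *∈ u +∈ fromℕ∈ N *∈ v)
    denominator (neg-in {x} p) with N , N≢0 , u ← denominator p =
      N , N≢0 , resp (solve 2 (λ n x → :- (n :* x) := n :* :- x) refl (fromℕ K N) x) (-∈ u)
    denominator (*-in {x} {y} p q) with N , N≢0 , u ← denominator p | M , M≢0 , v ← denominator q =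
      N ℕ.* M , ℕ.m*n≢0 N M {{N≢0}} {{M≢0}} , resp
        (trans (solve 4 (λ n m x y → n :* x :* (m :* y) := n :* m :* (x :* y)) refl (fromℕ K N) (fromℕ K M) x y) (*-congʳ (sym (×1-homo-* N M))))
        (u *∈ v)
    -- A multiple N x w = M of the nonzero element N x, multiplied by y = 1/x, gives M y = N w in
    -- `A`.
    denominator (inv-in {x} {y} xy≈1 p) with N , N≢0 , u ← denominator p
      with w , M , M≢0 , w∈ , e ← norm u (λ Nx≈0 → 1≉0 (trans (sym xy≈1) (trans (*-congʳ (*-cancelˡ-0 (fromℕ≉0 N {{N≢0}}) Nx≈0)) (zeroˡ y)))) =
      M , M≢0 , resp (≈-modulo (fromℕ K N * w) (≈-modulo (- y)
        (solve 5 (λ n m x y w → n :* w := m :* y :+ n :* w :* (x :^ 0 :- x :* y) :+ :- y :* (m :- n :* x :* w))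
          refl (fromℕ K N) (fromℕ K M) x y w) (sym e)) (sym xy≈1))
        (fromℕ∈ N *∈ w∈)
    denominator (resp-in x≈y p) with N , N≢0 , u ← denominator p = N , N≢0 , resp (*-congˡ x≈y) u


-- Sums of two and of three squares in a ring where x⁴ ≡ x modulo 2.

module SumsOfSquares {c ℓ₁ ℓ₂} (K : HeytingField c ℓ₁ ℓ₂) where

  open Subrings K

  module _ {p} {𝒪 : Carrier → Set p} (S : IsSubring 𝒪) (frobenius² : ∀ {x} → 𝒪 x → Even 𝒪 (x ^ 4 - x)) where

    open IsSubring S
    open Parity S

    -- The form X² + Y² + Z² is isotropic along v = (a, b, 1). The vector w = (- b u, - a u, 1 + 2abu)
    -- pairs with v to 1, and with u = x² - 1 its value is congruent to x⁴ and so to x modulo 2;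
    -- hence w + t v represents x for a suitable t.
    three-squares : ∀ {a b} → 𝒪 a → 𝒪 b → - 1# ≈ a * a + b * b →
      ∀ {x} → 𝒪 x → ∃[ X ] ∃[ Y ] ∃[ Z ] (𝒪 X × 𝒪 Y × 𝒪 Z × x ≈ X * X + (Y * Y + Z * Z))
    three-squares {a} {b} a∈ b∈ -1≈a²+b² {x} x∈ with z , z∈ , x⁴-x≈2z ← frobenius² x∈ =
      - (b * u) + t * a , - (a * u) + t * b , 1# + 2# * (a * b * u) + t ,
      -∈ (b∈ *∈ u∈) +∈ t∈ *∈ a∈ , -∈ (a∈ *∈ u∈) +∈ t∈ *∈ b∈ , 1∈ +∈ ι∈ (+ 2) *∈ (a∈ *∈ b∈ *∈ u∈) +∈ t∈ ,
      ≈-modulo (u * u + t * t) (≈-modulo (- 1#) identity x⁴-x≈2z) -1≈a²+b²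
      where
      u = x * x - 1#
      u∈ : 𝒪 u
      u∈ = x∈ *∈ x∈ -∈ 1∈
      -- For the form q = X² + Y² + Z², q(v) = 0 and the pairing 1 give q(w + t v) = q(w) + 2t. So t
      -- is (x - q(w)) / 2, with q(w) = - u² + (1 + 2abu)² and 2z = x⁴ - x.
      t = u * u + u - z - 2# * (a * b * u) - 2# * (a * b * u * (a * b * u))
      t∈ : 𝒪 t
      t∈ = u∈ *∈ u∈ +∈ u∈ -∈ z∈ -∈ ι∈ (+ 2) *∈ (a∈ *∈ b∈ *∈ u∈) -∈ ι∈ (+ 2) *∈ (a∈ *∈ b∈ *∈ u∈ *∈ (a∈ *∈ b∈ *∈ u∈))
      expand : ∀ t → (- (b * u) + t * a) * (- (b * u) + t * a) + ((- (a * u) + t * b) * (- (a * u) + t * b)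
          + (1# + 2# * (a * b * u) + t) * (1# + 2# * (a * b * u) + t))
        ≈ (u * u + t * t) * (a * a + b * b) + t * t + (1# + 2# * (a * b * u)) * (1# + 2# * (a * b * u)) + 2# * t
      expand t = solve 4 (λ a b u t →
        (:- (b :* u) :+ t :* a) :* (:- (b :* u) :+ t :* a) :+ ((:- (a :* u) :+ t :* b) :* (:- (a :* u) :+ t :* b)
          :+ (a :^ 0 :+ con (+ 2) :* (a :* b :* u) :+ t) :* (a :^ 0 :+ con (+ 2) :* (a :* b :* u) :+ t))
        := (u :* u :+ t :* t) :* (a :* a :+ b :* b) :+ t :* t :+ (a :^ 0 :+ con (+ 2) :* (a :* b :* u)) :* (a :^ 0 :+ con (+ 2) :* (a :* b :* u)) :+ con (+ 2) :* t)
        refl a b u t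
      identity : x ≈ (- (b * u) + t * a) * (- (b * u) + t * a) + ((- (a * u) + t * b) * (- (a * u) + t * b)
          + (1# + 2# * (a * b * u) + t) * (1# + 2# * (a * b * u) + t))
        + (u * u + t * t) * (- 1# - (a * a + b * b)) + - 1# * (x ^ 4 - x - 2# * z)
      identity = sym (trans (+-congʳ (+-congʳ (expand t))) (trans
        (solve 5 (λ s m u t w → (u :* u :+ t :* t) :* s :+ t :* t :+ m :+ con (+ 2) :* t :+ (u :* u :+ t :* t) :* (:- (s :^ 0) :- s) :+ w
           := (m :+ con (+ 2) :* t :- u :* u) :+ w) refl (a * a + b * b) ((1# + 2# * (a * b * u)) * (1# + 2# * (a * b * u))) u t (- 1# * (x ^ 4 - x - 2# * z)))
        (solve 3 (λ k x z → let u = x :* x :- x :^ 0 in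
          (((k :^ 0 :+ con (+ 2) :* (k :* u)) :* (k :^ 0 :+ con (+ 2) :* (k :* u)))
            :+ con (+ 2) :* (u :* u :+ u :- z :- con (+ 2) :* (k :* u) :- con (+ 2) :* (k :* u :* (k :* u))) :- u :* u)
            :+ :- (k :^ 0) :* (x :^ 4 :- x :- con (+ 2) :* z) := x) refl (a * b) x z)))

    -- As squares are additive modulo 2, e + f + 1 = 2t is even; substitute f = 2t - 1 - e.
    two-squares-mod-4 : (∀ {x y} → 2# * x ≈ 2# * y → x ≈ y) →
      ∀ {e f w} → 𝒪 e → 𝒪 f → 𝒪 w → 1# + 2# * w ≈ e * e + f * f → Even 𝒪 (w - (e * e + e))
    two-squares-mod-4 2-cancel {e} {f} {w} e∈ f∈ w∈ h
      -- By the hypothesis (e + f + 1)² = 2 (e f + e + f + 1 + w), so `even-root` applies.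
      with t , t∈ , e+f+1≈2t ← even-root (e∈ +∈ f∈ +∈ 1∈) (frobenius² (e∈ +∈ f∈ +∈ 1∈)) (even-resp
        (≈-modulo (- 1#) (solve 3 (λ e f w → con (+ 2) :* (e :* f :+ e :+ f :+ e :^ 0 :+ w) := (e :+ f :+ e :^ 0) :* (e :+ f :+ e :^ 0)
          :+ :- (e :^ 0) :* ((e :* e :+ f :* f) :- (e :^ 0 :+ con (+ 2) :* w))) refl e f w) (sym h))
        (2*-even (e∈ *∈ f∈ +∈ e∈ +∈ f∈ +∈ 1∈ +∈ w∈))) =
      t * t - t - t * e , t∈ *∈ t∈ -∈ t∈ -∈ t∈ *∈ e∈ , 2-cancel (≈-modulo 1# (≈-modulo (f - 1# - e + 2# * t)
        (solve 4 (λ e f w t → con (+ 2) :* (w :- (e :* e :+ e)) := con (+ 2) :* (con (+ 2) :* (t :* t :- t :- t :* e))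
          :+ e :^ 0 :* ((e :^ 0 :+ con (+ 2) :* w) :- (e :* e :+ f :* f))
          :+ (f :- e :^ 0 :- e :+ con (+ 2) :* t) :* ((e :+ f :+ e :^ 0) :- con (+ 2) :* t)) refl e f w t) e+f+1≈2t) h)

    -- Modulo 2, a² + a = 1, whereas every w = e² + e has w² + w = e⁴ - e = 0.
    1+2a-not-two-squares : (∀ {x y} → 2# * x ≈ 2# * y → x ≈ y) → ¬ Even 𝒪 1# →
      ∀ {a b} → 𝒪 a → 𝒪 b → - 1# ≈ a * a + b * b → ∀ {e f} → 𝒪 e → 𝒪 f → ¬ 1# + 2# * a ≈ e * e + f * f
    1+2a-not-two-squares 2-cancel 1-odd {a} {b} a∈ b∈ -1≈a²+b² {e} {f} e∈ f∈ h = 1-odd (even-resp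
      (solve 2 (λ a e → :- (:- (a :^ 0) :- (a :* a :+ a)) :+ :- ((a :+ (e :* e :+ e) :+ a :^ 0) :* (a :- (e :* e :+ e))
        :+ ((e :^ 4 :- e) :+ con (+ 2) :* (e :* e :* e :+ e :* e :+ e))) := a :^ 0) refl a e)
      -- The choice w = -1 fits because 1 + 2 (-1) = -1 = a² + b²; it yields -1 ≡ a² + a modulo 2.
      (even-+ (even-neg (two-squares-mod-4 2-cancel a∈ b∈ (-∈ 1∈)
          (trans (solve 1 (λ a → a :^ 0 :+ con (+ 2) :* :- (a :^ 0) := :- (a :^ 0)) refl a) -1≈a²+b²)))
        (even-neg (even-+ (even-* (a∈ +∈ (e∈ *∈ e∈ +∈ e∈) +∈ 1∈) (two-squares-mod-4 2-cancel e∈ f∈ a∈ h))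
          (even-+ (frobenius² e∈) (2*-even (e∈ *∈ e∈ *∈ e∈ +∈ e∈ *∈ e∈ +∈ e∈)))))))



-- The order ℤ[δ, ε] and the ring of integers of ℚ(√-m, √n).

module RingOfIntegers {c ℓ₁ ℓ₂} (K : HeytingField c ℓ₁ ℓ₂) {m n : ℕ} (ℚ√ : IsℚAdjoin√ K m n) where

  open IsℚAdjoin√ ℚ√
  open Orders K discrete characteristicZero
  open QuadraticExtension K discrete characteristicZero
  open Denominators K discrete characteristicZero
  open SumsOfSquares K

  -- What is adjoined is (1 + ρ)/2, a root of X² - X + γ.
  adjoin-root : ∀ {p} {A : Carrier → Set p} → IsOrder A → ∀ γ {ρ} → 1# - ρ * ρ ≈ ι (+ 4) * ι γ → ¬ ρ ≈ 0# →
    Σ[ B ∈ (Carrier → Set (c ⊔ ℓ₁ ⊔ p)) ] (IsOrder B × (∀ {x} → A x → B x) × B ρ)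
  adjoin-root {A = A} order γ {ρ} e ρ≉0 =
    Adjoin A θ , adjoin-order order γ θ² 2θ-1≉0 , extend order γ θ² 2θ-1≉0 ,
    resp 2θ-1≈ρ (ι∈ (+ 2) *∈ generator order γ θ² 2θ-1≉0 -∈ 1∈)
    where
    h = proj₁ (inverse 2≉0)
    2h≈1 = proj₂ (inverse 2≉0)
    θ = h * (1# + ρ)
    2θ-1≈ρ : 2# * θ - 1# ≈ ρ
    2θ-1≈ρ = ≈-modulo (1# + ρ)
      (solve 2 (λ h ρ → con (+ 2) :* (h :* (h :^ 0 :+ ρ)) :- h :^ 0 := ρ :+ (h :^ 0 :+ ρ) :* (con (+ 2) :* h :- h :^ 0)) refl h ρ) 2h≈1
    2θ-1≉0 : ¬ 2# * θ - 1# ≈ 0#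
    2θ-1≉0 f = ρ≉0 (trans (sym 2θ-1≈ρ) f)
    θ² : θ * θ ≈ θ - ι γ
    θ² = ≈-modulo (- (h * h)) (≈-modulo (h * (1# + ρ) - ι γ * (2# * h + 1#))
      (solve 3 (λ h ρ g → h :* (h :^ 0 :+ ρ) :* (h :* (h :^ 0 :+ ρ)) := h :* (h :^ 0 :+ ρ) :- g
        :+ :- (h :* h) :* ((h :^ 0 :- ρ :* ρ) :- con (+ 4) :* g)
        :+ (h :* (h :^ 0 :+ ρ) :- g :* (con (+ 2) :* h :+ h :^ 0)) :* (con (+ 2) :* h :- h :^ 0)) refl h ρ (ι γ)) 2h≈1) e
    open IsSubring (adjoin-subring order γ θ² 2θ-1≉0)

  fromℕ-mod-4 : ∀ k {r} → k % 4 ≡ r → fromℕ K k ≈ fromℕ K r + fromℕ K (k / 4) * ι (+ 4)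
  fromℕ-mod-4 k {r} k%4≡r = trans (×-congˡ (≡.trans (m≡m%n+[m/n]*n k 4) (≡.cong (ℕ._+ k / 4 ℕ.* 4) k%4≡r)))
    (trans (×-homo-+ 1# r (k / 4 ℕ.* 4)) (+-congˡ (×1-homo-* (k / 4) 4)))

  α≉0 : NonZero m → ¬ α ≈ 0#
  α≉0 m≢0 α≈0 = fromℕ≉0 m {{m≢0}} (trans (solve 1 (λ k → k := :- :- k) refl (fromℕ K m))
    (trans (-‿cong (trans (sym α²≈-m) (trans (*-congʳ α≈0) (zeroˡ α)))) (solve 0 (:- con (+ 0) := con (+ 0)) refl)))

  β≉0 : NonZero n → ¬ β ≈ 0#
  β≉0 n≢0 β≈0 = fromℕ≉0 n {{n≢0}} (trans (sym β²≈n) (trans (*-congʳ β≈0) (zeroˡ β)))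

  -- The constant term (1 - ρ²) / 4 is (1 + m) / 4 for ρ = α, one more than the integer quotient as
  -- m leaves remainder 3; for ρ = β it is (1 - n) / 4.
  1-α² : m % 4 ≡ 3 → 1# - α * α ≈ ι (+ 4) * ι (+ suc (m / 4))
  1-α² m%4≡3 = trans (+-congˡ (-‿cong (trans α²≈-m (-‿cong (fromℕ-mod-4 m m%4≡3)))))
    (solve 1 (λ q → q :^ 0 :- :- (con (+ 3) :+ q :* con (+ 4)) := con (+ 4) :* (q :^ 0 :+ q)) refl (fromℕ K (m / 4)))

  1-β² : n % 4 ≡ 1 → 1# - β * β ≈ ι (+ 4) * ι (ℤ.- (+ (n / 4)))
  1-β² n%4≡1 = trans (+-congˡ (-‿cong (trans β²≈n (fromℕ-mod-4 n n%4≡1))))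
    (trans (solve 1 (λ q → q :^ 0 :- (con (+ 1) :+ q :* con (+ 4)) := con (+ 4) :* :- q) refl (fromℕ K (n / 4)))
      (*-congˡ (sym (ι-neg (+ (n / 4))))))

  -- `𝒪` is any description equivalent to `Integral`; the ring structure is then available from the
  -- description by common denominators.
  s≡2⇒g≡3 : ∀ {p} {𝒪 : Carrier → Set p} → IsSubring 𝒪 → (∀ {x} → 𝒪 x → Even 𝒪 (x ^ 4 - x)) →
    (∀ {x} → Integral K x → 𝒪 x) → (∀ {x} → 𝒪 x → Integral K x) → s[𝓞]≡ K 2 → g[𝓞]≡ K 3
  s≡2⇒g≡3 {𝒪 = 𝒪} 𝒪-subring frobenius² to-𝒪 from-𝒪 (_ , (y , y-integral , -1≈y²) , s-minimal) = _ , every-three , at-least-three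
    where
    open IsSubring 𝒪-subring

    1-odd : ¬ Even 𝒪 1#
    1-odd (z , z∈ , 1≈2z) = half-not-integral (sym 1≈2z) (from-𝒪 z∈)

    a b : Carrier
    a = y Fin.zero
    b = y (Fin.suc Fin.zero)

    a∈ : 𝒪 a
    a∈ = to-𝒪 (y-integral Fin.zero)

    b∈ : 𝒪 b
    b∈ = to-𝒪 (y-integral (Fin.suc Fin.zero))

    -1≈a²+b² : - 1# ≈ a * a + b * b
    -1≈a²+b² = trans -1≈y² (+-congˡ (+-identityʳ _))

    every-three : ∀ x → Integral K x → IsSumOfSquares K 3 x
    every-three x x-integral =
      let X , Y , Z , X∈ , Y∈ , Z∈ , e = three-squares 𝒪-subring frobenius² a∈ b∈ -1≈a²+b² (to-𝒪 x-integral) in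
      lookup (X ∷ Y ∷ Z ∷ []) ,
      (λ { Fin.zero → from-𝒪 X∈ ; (Fin.suc Fin.zero) → from-𝒪 Y∈ ; (Fin.suc (Fin.suc Fin.zero)) → from-𝒪 Z∈ }) ,
      trans e (+-congˡ (+-congˡ (sym (+-identityʳ _))))

    at-least-three : ∀ j → NonZero j → (∀ x → Integral K x → IsSumOfSquares K j x) → 3 ℕ.≤ j
    -- If one square always sufficed, -1 would be a square, against the minimality of s = 2.
    at-least-three 1 _ sums with ℕ.s≤s () ← s-minimal 1 _ (sums (- 1#) (from-𝒪 (-∈ 1∈)))
    at-least-three 2 _ sums =
      let r , r-integral , e = sums (1# + 2# * a) (from-𝒪 (1∈ +∈ ι∈ (+ 2) *∈ a∈)) in
      contradiction (trans e (+-congˡ (+-identityʳ _)))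
        (1+2a-not-two-squares 𝒪-subring frobenius² (*-cancelˡ 2≉0) 1-odd a∈ b∈ -1≈a²+b²
          (to-𝒪 (r-integral Fin.zero)) (to-𝒪 (r-integral (Fin.suc Fin.zero))))
    at-least-three (suc (suc (suc j))) _ _ = ℕ.s≤s (ℕ.s≤s (ℕ.s≤s ℕ.z≤n))

  -- The order contains α = 2δ - 1 and β = 2ε - 1, which generate K, so every element of K has a
  -- denominator with respect to it.
  g≡3 : NonZero m → NonZero n → m % 4 ≡ 3 → n % 4 ≡ 1 → s[𝓞]≡ K 2 → g[𝓞]≡ K 3
  g≡3 m≢0 n≢0 m%4≡3 n%4≡1 =
    let _ , ℤ[δ]-order   , _       , α∈ = adjoin-root integers-order (+ suc (m / 4)) (1-α² m%4≡3) (α≉0 m≢0)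
        _ , ℤ[δ,ε]-order , include , β∈ = adjoin-root ℤ[δ]-order (ℤ.- (+ (n / 4))) (1-β² n%4≡1) (β≉0 n≢0)
    in s≡2⇒g≡3 (almostIntegral-subring ℤ[δ,ε]-order) (almostIntegral-frobenius² ℤ[δ,ε]-order)
         (integral⇒almostIntegral ℤ[δ,ε]-order (λ x → denominator ℤ[δ,ε]-order (include α∈) β∈ (generated x)))
         (almostIntegral⇒integral ℤ[δ,ε]-order)

corollary1p1 : ∀ {c ℓ₁ ℓ₂ : Level} (m n : ℕ) → NonZero m → NonZero n → m ≢ n →
    m % 4 ≡ 3 → n % 4 ≡ 1 → SquareFree m → SquareFree n →
    (K : HeytingField c ℓ₁ ℓ₂) → IsℚAdjoin√ K m n →
    s[𝓞]≡ K 2 → g[𝓞]≡ K 3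
corollary1p1 m n m≢0 n≢0 _ m%4≡3 n%4≡1 _ _ K ℚ√ = RingOfIntegers.g≡3 K ℚ√ m≢0 n≢0 m%4≡3 n%4≡1
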